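{- The variety $\mathsf{ImpBiLat}$ of implicative bilattices is a discriminator variety.
   Context: A bilattice is an algebra $\langle B,\land,\lor,\otimes,\oplus,\neg\rangle$ such that $\langle B,\land,\lor\rangle$ and $\langle B,\otimes,\oplus\rangle$ are lattices (not necessarily bounded) with orders $\leq_t$ and $\leq_k$, and $\neg$ is unary with: $a\leq_t b\Rightarrow\neg b\leq_t\neg a$; $a\leq_k b\Rightarrow\neg a\leq_k\neg b$; $\neg\neg a=a$. An implicative bilattice is an algebra $\langle B,\land,\lor,\otimes,\oplus,\supset,\neg\rangle$ whose $\supset$-free reduct is a bilattice and which satisfies: (IB1) $(x\supset x)\supset y\approx y$; (IB2) $x\supset(y\supset z)\approx(x\land y)\supset z\approx(x\otimes y)\supset z$; (IB3) $((x\supset y)\supset x)\supset x\approx x\supset x$; (IB4) $(x\lor y)\supset z\approx(x\supset z)\land(y\supset z)\approx(x\oplus y)\supset z$; (IB5) $x\land((x\supset y)\supset(x\otimes y))\approx x$; (IB6) $\neg(x\supset y)\supset z\approx(x\land\neg y)\supset z$. A variety is a discriminator variety if it is generated by a class $\mathsf K$ of algebras for which there is a single ternary term $t(x,y,z)$ inducing on every member of $\mathsf K$ the discriminator function: $t(a,b,c)=c$ if $a=b$, and $t(a,b,c)=a$ if $a\neq b$. -}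

module Defs where

open import Algebra.Core using (Op₁; Op₂)
import Algebra.Lattice.Structures as LatticeStructures
open import Data.Fin.Base using (Fin)
open import Data.Nat.Base using (ℕ)
open import Data.Product.Base using (_×_; _,_; Σ-syntax)
open import Data.Vec.Functional using (Vector; []; _∷_)
open import Data.Vec.Functional.Relation.Binary.Pointwise using (Pointwise)
open import Level using (Level; 0ℓ; suc; _⊔_)
open import Relation.Binary.Bundles using (Setoid)
import Relation.Binary.Construct.NaturalOrder.Left as NaturalOrder
open import Relation.Nullary.Negation.Core using (¬_)
open import Relation.Unary using (Pred; _∈_; _⊆_; _≐_)

private
  variable
    c ℓ v : Level

------------------------------------------------------------------------
-- Universal algebra

record Signature : Set₁ where
  field
    Operation : Set
    arity     : Operation → ℕ

-- The carrier is not required to be inhabited.  This does not affect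
-- varieties generated by a class: the algebra on an empty carrier (for a
-- signature without constants) satisfies every equation.
record Algebra (S : Signature) (c ℓ : Level) : Set (suc (c ⊔ ℓ)) where
  open Signature S
  field
    setoid : Setoid c ℓ
  open Setoid setoid public
  field
    interp      : (f : Operation) → Vector Carrier (arity f) → Carrier
    interp-cong : ∀ f {xs ys} → Pointwise _≈_ xs ys → interp f xs ≈ interp f ys

data Term (S : Signature) (X : Set) : Set where
  var : X → Term S X
  op  : (f : Signature.Operation S) →
        Vector (Term S X) (Signature.arity S f) → Term S X

module _ {S : Signature} where

  eval : (A : Algebra S c ℓ) {X : Set} →
         (X → Algebra.Carrier A) → Term S X → Algebra.Carrier A
  eval A ρ (var x)   = ρ x
  eval A ρ (op f ts) = Algebra.interp A f (λ i → eval A ρ (ts i))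

Equation : Signature → Set
Equation S = Term S ℕ × Term S ℕ

module _ {S : Signature} where

  infix 4 _⊨_

  _⊨_ : Algebra S c ℓ → Equation S → Set (c ⊔ ℓ)
  A ⊨ (s , t) = (ρ : ℕ → Carrier) → eval A ρ s ≈ eval A ρ t
    where open Algebra A

  Mod : Pred (Equation S) 0ℓ → Pred (Algebra S c ℓ) (c ⊔ ℓ)
  Mod E A = ∀ e → e ∈ E → A ⊨ e

  -- A variety is an equational class.
  IsVariety : Pred (Algebra S c ℓ) v → Set _
  IsVariety V = Σ[ E ∈ Pred (Equation S) 0ℓ ] (V ≐ Mod E)

  -- V is the least variety containing K.  Taking sets of equations at
  -- level 0ℓ loses nothing, as every singleton lives there.
  record _IsGeneratedBy_ {c ℓ v k} (V : Pred (Algebra S c ℓ) v)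
                         (K : Pred (Algebra S c ℓ) k)
                         : Set (suc (c ⊔ ℓ) ⊔ v ⊔ k) where
    field
      isVariety : IsVariety V
      contains  : K ⊆ V
      least     : (E : Pred (Equation S) 0ℓ) → K ⊆ Mod E → V ⊆ Mod E

  record InducesDiscriminator {c ℓ} (t : Term S (Fin 3)) (A : Algebra S c ℓ)
                              : Set (c ⊔ ℓ) where
    open Algebra A

    induced : Carrier → Carrier → Carrier → Carrier
    induced x y z = eval A (x ∷ y ∷ z ∷ []) t

    field
      equal   : ∀ x y z → x ≈ y → induced x y z ≈ z
      unequal : ∀ x y z → ¬ (x ≈ y) → induced x y z ≈ x

  IsDiscriminatorVariety : Pred (Algebra S c ℓ) v → Set _
  IsDiscriminatorVariety {c} {ℓ} V =
    Σ[ K ∈ Pred (Algebra S c ℓ) (suc (c ⊔ ℓ)) ]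
    Σ[ t ∈ Term S (Fin 3) ]
      (V IsGeneratedBy K × (∀ A → A ∈ K → InducesDiscriminator t A))

------------------------------------------------------------------------
-- Implicative bilattices

data Symbol : Set where
  ∧′ ∨′ ⊗′ ⊕′ ⊃′ ¬′ : Symbol

implicativeBilatticeSignature : Signature
implicativeBilatticeSignature = record
  { Operation = Symbol
  ; arity     = λ { ∧′ → 2 ; ∨′ → 2 ; ⊗′ → 2 ; ⊕′ → 2 ; ⊃′ → 2 ; ¬′ → 1 }
  }

module Operations (B : Algebra implicativeBilatticeSignature c ℓ) where
  open Algebra B

  infix  8 ∼_
  infixr 7 _∧_ _⊗_
  infixr 6 _∨_ _⊕_
  infixr 5 _⊃_

  _∧_ _∨_ _⊗_ _⊕_ _⊃_ : Op₂ Carrier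
  x ∧ y = interp ∧′ (x ∷ y ∷ [])
  x ∨ y = interp ∨′ (x ∷ y ∷ [])
  x ⊗ y = interp ⊗′ (x ∷ y ∷ [])
  x ⊕ y = interp ⊕′ (x ∷ y ∷ [])
  x ⊃ y = interp ⊃′ (x ∷ y ∷ [])

  -- The negation of the bilattice; ¬_ is negation of types.
  ∼_ : Op₁ Carrier
  ∼ x = interp ¬′ (x ∷ [])

  open NaturalOrder _≈_ _∧_ public using () renaming (_≤_ to _≤ₜ_)
  open NaturalOrder _≈_ _⊗_ public using () renaming (_≤_ to _≤ₖ_)

record IsBilattice (B : Algebra implicativeBilatticeSignature c ℓ)
                   : Set (c ⊔ ℓ) where
  open Algebra B
  open Operations B
  open LatticeStructures _≈_ using (IsLattice)
  field
    isLatticeₜ   : IsLattice _∨_ _∧_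
    isLatticeₖ   : IsLattice _⊕_ _⊗_
    ∼-antitoneₜ  : ∀ x y → x ≤ₜ y → ∼ y ≤ₜ ∼ x
    ∼-monotoneₖ  : ∀ x y → x ≤ₖ y → ∼ x ≤ₖ ∼ y
    ∼-involutive : ∀ x → ∼ ∼ x ≈ x

record IsImplicativeBilattice (B : Algebra implicativeBilatticeSignature c ℓ)
                              : Set (c ⊔ ℓ) where
  open Algebra B
  open Operations B
  field
    isBilattice : IsBilattice B
    ib1  : ∀ x y → (x ⊃ x) ⊃ y ≈ y
    ib2∧ : ∀ x y z → x ⊃ (y ⊃ z) ≈ (x ∧ y) ⊃ z
    ib2⊗ : ∀ x y z → (x ∧ y) ⊃ z ≈ (x ⊗ y) ⊃ z
    ib3  : ∀ x y → ((x ⊃ y) ⊃ x) ⊃ x ≈ x ⊃ x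
    ib4∨ : ∀ x y z → (x ∨ y) ⊃ z ≈ (x ⊃ z) ∧ (y ⊃ z)
    ib4⊕ : ∀ x y z → (x ⊃ z) ∧ (y ⊃ z) ≈ (x ⊕ y) ⊃ z
    ib5  : ∀ x y → x ∧ ((x ⊃ y) ⊃ (x ⊗ y)) ≈ x
    ib6  : ∀ x y z → ∼ (x ⊃ y) ⊃ z ≈ (x ∧ ∼ y) ⊃ z

ImpBiLat : (c ℓ : Level) → Pred (Algebra implicativeBilatticeSignature c ℓ) (c ⊔ ℓ)
ImpBiLat c ℓ = IsImplicativeBilattice

{-# OPTIONS --safe #-}
-- In an implicative bilattice let a ≼ b mean that a ⊃ b is designated, i.e.
-- (a ⊃ b) ⊃ y ≈ y for all y.  This preorder makes ∧ and ⊗ meets, ∨ and ⊕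
-- joins and ⊃ a residual satisfying Peirce's law, while a ≈ b as soon as
-- a ≼ b ≼ a and ∼ a ≼ ∼ b ≼ ∼ a.  An equation thus amounts to inequalities of
-- classical positive logic in the literals x and ∼ x, which Kalmár's method
-- reduces to truth tables.  Hence the four-element algebra on Bool × Bool, on
-- which the discriminator is a term function, generates the variety.
module Submission where

open import Defs
open import Algebra.Lattice.Bundles using (Lattice)
import Algebra.Lattice.Properties.Lattice as LatticeProperties
open import Data.Bool.Base as Bool using (Bool; true; false; not)
import Data.Bool.Properties as Bool
open import Data.Fin.Base using (Fin; toℕ)
open import Data.Fin.Patterns using (0F; 1F; 2F)
open import Data.List.Base as List using (List; _++_; concat)
open import Data.List.Membership.Propositional using (_∈_)
open import Data.List.Membership.Propositional.Properties
  using (∈-concat⁺′; ∈-tabulate⁺; ∈-++⁺ˡ; ∈-++⁺ʳ)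
open import Data.List.Relation.Unary.Any using (here; there)
open import Data.Nat.Base using (ℕ)
import Data.Nat.Properties as ℕ
open import Data.Product.Base using (_×_; _,_; proj₁; proj₂; swap)
open import Data.Product.Properties using (≡-dec)
open import Data.Sum.Base using (_⊎_; [_,_]′)
open import Data.Vec.Functional using (Vector; []; _∷_)
open import Function.Base using (_∘_; case_of_)
open import Level using (Level; 0ℓ; _⊔_; Lift; lift; lower)
import Relation.Binary.Construct.Flip.EqAndOrd as Flip
open import Relation.Binary.Core using (Rel)
open import Relation.Binary.Definitions using (DecidableEquality)
open import Relation.Binary.Lattice using (Supremum)
import Relation.Binary.Lattice.Structures as Order
import Relation.Binary.Reasoning.Setoid as SetoidReasoning
open import Relation.Binary.PropositionalEquality as ≡ using (_≡_; cong; cong₂)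
open import Relation.Binary.Structures using (IsPartialOrder)
open import Relation.Nullary.Decidable
  using (Dec; yes; no; True; toWitness; from-yes; map′; _×-dec_; _⊎-dec_)
open import Relation.Nullary.Negation using (contradiction)

private
  variable
    a c ℓ ℓ₁ ℓ₂ : Level
    X Y : Set

-- Terms over an arbitrary signature

module _ {S : Signature} where
  open Signature S

  rename : (X → Y) → Term S X → Term S Y
  rename g (var x)   = var (g x)
  rename g (op f ts) = op f (λ i → rename g (ts i))

  eval-rename : (A : Algebra S c ℓ) → let open Algebra A in
                {g : X → Y} {ρ : Y → Carrier} {σ : X → Carrier} →
                (∀ x → ρ (g x) ≈ σ x) →
                ∀ t → eval A ρ (rename g t) ≈ eval A σ t
  eval-rename A eq (var x)   = eq x
  eval-rename A eq (op f ts) =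
    Algebra.interp-cong A f (λ i → eval-rename A eq (ts i))

  variables : Term S X → List X
  variables (var x)   = List.[ x ]
  variables (op f ts) = concat (List.tabulate (λ i → variables (ts i)))

  variables-op : ∀ f (ts : Vector (Term S X) (arity f)) i {x} →
                 x ∈ variables (ts i) → x ∈ variables (op f ts)
  variables-op f ts i x∈ =
    ∈-concat⁺′ x∈ (∈-tabulate⁺ {f = λ i → variables (ts i)} i)

  -- `four` lives at level `0ℓ`, whereas the generating class consists of algebras at arbitrary
  -- levels.
  liftAlgebra : ∀ c ℓ → Algebra S 0ℓ 0ℓ → Algebra S c ℓ
  liftAlgebra c ℓ A = record
    { setoid = record
      { Carrier       = Lift c Carrier
      ; _≈_           = λ x y → Lift ℓ (lower x ≈ lower y)
      ; isEquivalence = record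
        { refl  = lift refl
        ; sym   = λ p → lift (sym (lower p))
        ; trans = λ p q → lift (trans (lower p) (lower q))
        }
      }
    ; interp      = λ f xs → lift (interp f (lower ∘ xs))
    ; interp-cong = λ f eqs → lift (interp-cong f (lower ∘ eqs))
    }
    where open Algebra A

  module _ (c ℓ : Level) (A : Algebra S 0ℓ 0ℓ) where
    open Algebra A
    private A↑ = liftAlgebra c ℓ A

    eval-lift : (ρ : X → Lift c Carrier) (t : Term S X) →
                lower (eval A↑ ρ t) ≈ eval A (lower ∘ ρ) t
    eval-lift ρ (var x)   = refl
    eval-lift ρ (op f ts) = interp-cong f (λ i → eval-lift ρ (ts i))

    ⊨-lift : ∀ e → A ⊨ e → A↑ ⊨ e
    ⊨-lift (s , t) A⊨e ρ = lift
      (trans (eval-lift ρ s) (trans (A⊨e (lower ∘ ρ)) (sym (eval-lift ρ t))))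

    ⊨-lower : ∀ e → A↑ ⊨ e → A ⊨ e
    ⊨-lower (s , t) A↑⊨e ρ =
      trans (sym (eval-lift (lift ∘ ρ) s))
        (trans (lower (A↑⊨e (lift ∘ ρ))) (eval-lift (lift ∘ ρ) t))

-- Terms of implicative bilattices

ImpTerm : Set → Set
ImpTerm = Term implicativeBilatticeSignature

infix  8 ∼̂_
infixr 7 _∧̂_ _⊗̂_
infixr 6 _∨̂_ _⊕̂_
infixr 5 _⊃̂_

_∧̂_ _∨̂_ _⊗̂_ _⊕̂_ _⊃̂_ : ImpTerm X → ImpTerm X → ImpTerm X
s ∧̂ t = op ∧′ (s ∷ t ∷ [])
s ∨̂ t = op ∨′ (s ∷ t ∷ [])
s ⊗̂ t = op ⊗′ (s ∷ t ∷ [])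
s ⊕̂ t = op ⊕′ (s ∷ t ∷ [])
s ⊃̂ t = op ⊃′ (s ∷ t ∷ [])

∼̂_ : ImpTerm X → ImpTerm X
∼̂ t = op ¬′ (t ∷ [])

module OperationProperties
  (B : Algebra implicativeBilatticeSignature c ℓ) where
  open Algebra B
  open Operations B
  open Signature implicativeBilatticeSignature using (arity)

  private
    pair-cong : {x x′ : Carrier} {ys : Vector Carrier 2} →
                x ≈ ys 0F → x′ ≈ ys 1F → ∀ i → (x ∷ x′ ∷ []) i ≈ ys i
    pair-cong p q 0F = p
    pair-cong p q 1F = q

  ∧-cong : ∀ {x x′ y y′} → x ≈ x′ → y ≈ y′ → x ∧ y ≈ x′ ∧ y′
  ∧-cong p q = interp-cong ∧′ (pair-cong p q)

  ∨-cong : ∀ {x x′ y y′} → x ≈ x′ → y ≈ y′ → x ∨ y ≈ x′ ∨ y′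
  ∨-cong p q = interp-cong ∨′ (pair-cong p q)

  ⊗-cong : ∀ {x x′ y y′} → x ≈ x′ → y ≈ y′ → x ⊗ y ≈ x′ ⊗ y′
  ⊗-cong p q = interp-cong ⊗′ (pair-cong p q)

  ⊕-cong : ∀ {x x′ y y′} → x ≈ x′ → y ≈ y′ → x ⊕ y ≈ x′ ⊕ y′
  ⊕-cong p q = interp-cong ⊕′ (pair-cong p q)

  ⊃-cong : ∀ {x x′ y y′} → x ≈ x′ → y ≈ y′ → x ⊃ y ≈ x′ ⊃ y′
  ⊃-cong p q = interp-cong ⊃′ (pair-cong p q)

  ∼-cong : ∀ {x x′} → x ≈ x′ → ∼ x ≈ ∼ x′
  ∼-cong p = interp-cong ¬′ λ { 0F → p }

  apply : ∀ f → Vector Carrier (arity f) → Carrier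
  apply ∧′ xs = xs 0F ∧ xs 1F
  apply ∨′ xs = xs 0F ∨ xs 1F
  apply ⊗′ xs = xs 0F ⊗ xs 1F
  apply ⊕′ xs = xs 0F ⊕ xs 1F
  apply ⊃′ xs = xs 0F ⊃ xs 1F
  apply ¬′ xs = ∼ xs 0F

  apply≈interp : ∀ f xs → apply f xs ≈ interp f xs
  apply≈interp ∧′ xs = interp-cong ∧′ (pair-cong refl refl)
  apply≈interp ∨′ xs = interp-cong ∨′ (pair-cong refl refl)
  apply≈interp ⊗′ xs = interp-cong ⊗′ (pair-cong refl refl)
  apply≈interp ⊕′ xs = interp-cong ⊕′ (pair-cong refl refl)
  apply≈interp ⊃′ xs = interp-cong ⊃′ (pair-cong refl refl)
  apply≈interp ¬′ xs = interp-cong ¬′ λ { 0F → refl }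

  -- Unlike eval, this computes to an expression in the operations.
  ⟦_⟧ : ImpTerm X → (X → Carrier) → Carrier
  ⟦ var x ⟧   ρ = ρ x
  ⟦ op f ts ⟧ ρ = apply f (λ i → ⟦ ts i ⟧ ρ)

  ⟦⟧≈eval : (ρ : X → Carrier) (t : ImpTerm X) → ⟦ t ⟧ ρ ≈ eval B ρ t
  ⟦⟧≈eval ρ (var x)   = refl
  ⟦⟧≈eval ρ (op f ts) =
    trans (apply≈interp f _) (interp-cong f (λ i → ⟦⟧≈eval ρ (ts i)))

-- The four-element implicative bilattice

Four : Set
Four = Bool × Bool

_≟_ : DecidableEquality Four
_≟_ = ≡-dec Bool._≟_ Bool._≟_

-- The components of a value record whether it is at least true, and whether
-- it is at least false, in the ≤ₖ order.
four : Algebra implicativeBilatticeSignature 0ℓ 0ℓ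
four = record
  { setoid      = ≡.setoid Four
  ; interp      = λ
    { ∧′ xs → and   (xs 0F) (xs 1F)
    ; ∨′ xs → or    (xs 0F) (xs 1F)
    ; ⊗′ xs → meet  (xs 0F) (xs 1F)
    ; ⊕′ xs → join  (xs 0F) (xs 1F)
    ; ⊃′ xs → imply (xs 0F) (xs 1F)
    ; ¬′ xs → swap  (xs 0F)
    }
  ; interp-cong = λ
    { ∧′ eq → cong₂ and   (eq 0F) (eq 1F)
    ; ∨′ eq → cong₂ or    (eq 0F) (eq 1F)
    ; ⊗′ eq → cong₂ meet  (eq 0F) (eq 1F)
    ; ⊕′ eq → cong₂ join  (eq 0F) (eq 1F)
    ; ⊃′ eq → cong₂ imply (eq 0F) (eq 1F)
    ; ¬′ eq → cong  swap  (eq 0F)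
    }
  }
  where
  and or meet join imply : Four → Four → Four
  and   (p , q) (p′ , q′) = p Bool.∧ p′       , q Bool.∨ q′
  or    (p , q) (p′ , q′) = p Bool.∨ p′       , q Bool.∧ q′
  meet  (p , q) (p′ , q′) = p Bool.∧ p′       , q Bool.∧ q′
  join  (p , q) (p′ , q′) = p Bool.∨ p′       , q Bool.∨ q′
  imply (p , q) (p′ , q′) = (not p) Bool.∨ p′ , p Bool.∧ q′

∀-bool? : {P : Bool → Set} → (∀ b → Dec (P b)) → Dec (∀ b → P b)
∀-bool? P? = map′ (λ { (p , q) true → p ; (p , q) false → q })
                  (λ h → h true , h false)
                  (P? true ×-dec P? false)

∀-four? : {P : Four → Set} → (∀ v → Dec (P v)) → Dec (∀ v → P v)
∀-four? P? = map′ (λ h v → h (proj₁ v) (proj₂ v)) (λ h p q → h (p , q))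
                  (∀-bool? λ p → ∀-bool? λ q → P? (p , q))

-- Classical reasoning in an implicative bilattice

-- `f` is an order isomorphism with itself as inverse, and isomorphisms preserve joins. Keeping the
-- two orders apart lets either of them be reversed, which yields all four laws for `∼`.
involution-preserves-⊔ :
  {A : Set a} {_≈_ : Rel A ℓ} {_≤₁_ : Rel A ℓ₁} {_≤₂_ : Rel A ℓ₂}
  {_⊔₁_ _⊔₂_ : A → A → A} {f : A → A} →
  IsPartialOrder _≈_ _≤₁_ → IsPartialOrder _≈_ _≤₂_ →
  Supremum _≤₁_ _⊔₁_ → Supremum _≤₂_ _⊔₂_ →
  (∀ {x y} → x ≤₁ y → f x ≤₂ f y) → (∀ {x y} → x ≤₂ y → f x ≤₁ f y) →
  (∀ x → f (f x) ≈ x) → ∀ x y → f (x ⊔₁ y) ≈ (f x ⊔₂ f y)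
involution-preserves-⊔ {_≤₁_ = _≤₁_} {_≤₂_} {_⊔₂_ = _⊔₂_} {f}
  po₁ po₂ sup₁ sup₂ mono₁ mono₂ involutive x y =
  P₂.antisym
    (P₂.trans (mono₁ (least₁ _ (below x≤) (below y≤)))
              (P₂.reflexive (involutive _)))
    (least₂ _ (mono₁ (proj₁ (sup₁ x y))) (mono₁ (proj₁ (proj₂ (sup₁ x y)))))
  where
  module P₁ = IsPartialOrder po₁
  module P₂ = IsPartialOrder po₂
  least₁ = proj₂ (proj₂ (sup₁ x y))
  x≤     = proj₁ (sup₂ (f x) (f y))
  y≤     = proj₁ (proj₂ (sup₂ (f x) (f y)))
  least₂ = proj₂ (proj₂ (sup₂ (f x) (f y)))
  below : ∀ {z} → f z ≤₂ (f x ⊔₂ f y) → z ≤₁ f (f x ⊔₂ f y)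
  below p = P₁.trans (P₁.reflexive (P₁.Eq.sym (involutive _))) (mono₂ p)

module Logic
  {B : Algebra implicativeBilatticeSignature c ℓ}
  (B∈ImpBiLat : IsImplicativeBilattice B) where
  open Algebra B
  open Operations B
  open OperationProperties B
  open IsImplicativeBilattice B∈ImpBiLat
  open IsBilattice isBilattice
  open SetoidReasoning setoid

  private
    latticeₜ latticeₖ : Lattice _ _
    latticeₜ = record { isLattice = isLatticeₜ }
    latticeₖ = record { isLattice = isLatticeₖ }

    module T = Lattice latticeₜ
    module K = Lattice latticeₖ
    module OT = Order.IsLattice
      (LatticeProperties.∨-∧-isOrderTheoreticLattice latticeₜ)
    module OK = Order.IsLattice
      (LatticeProperties.∨-∧-isOrderTheoreticLattice latticeₖ)

  -- De Morgan laws for negation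

  ∼-∧ : ∀ x y → ∼ (x ∧ y) ≈ ∼ x ∨ ∼ y
  ∼-∧ = involution-preserves-⊔
    (Flip.isPartialOrder OT.isPartialOrder) OT.isPartialOrder
    OT.infimum OT.supremum (∼-antitoneₜ _ _) (∼-antitoneₜ _ _) ∼-involutive

  ∼-∨ : ∀ x y → ∼ (x ∨ y) ≈ ∼ x ∧ ∼ y
  ∼-∨ = involution-preserves-⊔
    OT.isPartialOrder (Flip.isPartialOrder OT.isPartialOrder)
    OT.supremum OT.infimum (∼-antitoneₜ _ _) (∼-antitoneₜ _ _) ∼-involutive

  ∼-⊗ : ∀ x y → ∼ (x ⊗ y) ≈ ∼ x ⊗ ∼ y
  ∼-⊗ = involution-preserves-⊔
    (Flip.isPartialOrder OK.isPartialOrder)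
    (Flip.isPartialOrder OK.isPartialOrder)
    OK.infimum OK.infimum (∼-monotoneₖ _ _) (∼-monotoneₖ _ _) ∼-involutive

  ∼-⊕ : ∀ x y → ∼ (x ⊕ y) ≈ ∼ x ⊕ ∼ y
  ∼-⊕ = involution-preserves-⊔ OK.isPartialOrder OK.isPartialOrder
    OK.supremum OK.supremum (∼-monotoneₖ _ _) (∼-monotoneₖ _ _) ∼-involutive

  -- Designated elements and the preorder

  Designated : Carrier → Set _
  Designated x = ∀ y → x ⊃ y ≈ y

  Designated-resp : ∀ {x y} → x ≈ y → Designated x → Designated y
  Designated-resp x≈y Dx z = trans (⊃-cong (sym x≈y) refl) (Dx z)

  -- With `y` designated, `ib3` reduces to `(x ⊃ y) ⊃ y ≈ y`. Hence `x ⊃ y` equals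
  -- `(x ⊃ y) ⊃ (x ⊃ y)`, which is designated by `ib1`.
  Designated-⊃ : ∀ {x y} → Designated y → Designated (x ⊃ y)
  Designated-⊃ {x} {y} Dy = Designated-resp self (ib1 (x ⊃ y))
    where
    peirce : (x ⊃ y) ⊃ y ≈ y
    peirce = begin
      (x ⊃ y) ⊃ y        ≈⟨ ⊃-cong (⊃-cong (Dy x) refl) refl ⟨
      ((y ⊃ x) ⊃ y) ⊃ y  ≈⟨ ib3 y x ⟩
      y ⊃ y              ≈⟨ Dy y ⟩
      y                  ∎
    self : (x ⊃ y) ⊃ (x ⊃ y) ≈ x ⊃ y
    self = begin
      (x ⊃ y) ⊃ (x ⊃ y)  ≈⟨ ib2∧ (x ⊃ y) x y ⟩
      ((x ⊃ y) ∧ x) ⊃ y  ≈⟨ ⊃-cong (T.∧-comm _ _) refl ⟩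
      (x ∧ (x ⊃ y)) ⊃ y  ≈⟨ ib2∧ x (x ⊃ y) y ⟨
      x ⊃ ((x ⊃ y) ⊃ y)  ≈⟨ ⊃-cong refl peirce ⟩
      x ⊃ y              ∎

  infix 4 _≼_ _≋_

  _≼_ : Rel Carrier _
  x ≼ y = Designated (x ⊃ y)

  _≋_ : Rel Carrier _
  x ≋ y = x ≼ y × y ≼ x

  ≤ₜ⇒≼ : ∀ {x y} → x ≤ₜ y → x ≼ y
  ≤ₜ⇒≼ {x} {y} x≤y =
    Designated-resp (trans (ib2∧ x y y) (⊃-cong (sym x≤y) refl))
      (Designated-⊃ (ib1 y))

  ≼-refl : ∀ {x} → x ≼ x
  ≼-refl {x} = ib1 x

  ≈⇒≋ : ∀ {x y} → x ≈ y → x ≋ y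
  ≈⇒≋ x≈y = Designated-resp (⊃-cong refl x≈y) ≼-refl
          , Designated-resp (⊃-cong x≈y refl) ≼-refl

  ≼⇒≤ₜ⊗ : ∀ {x y} → x ≼ y → x ≤ₜ x ⊗ y
  ≼⇒≤ₜ⊗ {x} {y} x≼y = begin
    x                        ≈⟨ ib5 x y ⟨
    x ∧ ((x ⊃ y) ⊃ (x ⊗ y))  ≈⟨ ∧-cong refl (x≼y _) ⟩
    x ∧ (x ⊗ y)              ∎

  -- Once `x` is replaced by `x ∧ (x ⊗ y)`, `ib2∧` and `ib2⊗` unfold the antecedent into `x`, `x`
  -- and `y`. This is a cut rule: a consequence of `x` may be assumed beside `x`.
  ≼-absorb : ∀ {x y} → x ≼ y → ∀ z → x ⊃ z ≈ x ⊃ (y ⊃ z)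
  ≼-absorb {x} {y} x≼y z = begin
    x ⊃ z                ≈⟨ ⊃-cong (≼⇒≤ₜ⊗ x≼y) refl ⟩
    (x ∧ (x ⊗ y)) ⊃ z    ≈⟨ ib2∧ x (x ⊗ y) z ⟨
    x ⊃ ((x ⊗ y) ⊃ z)    ≈⟨ ⊃-cong refl (trans (ib2∧ x y z) (ib2⊗ x y z)) ⟨
    x ⊃ (x ⊃ (y ⊃ z))    ≈⟨ ib2∧ x x (y ⊃ z) ⟩
    (x ∧ x) ⊃ (y ⊃ z)    ≈⟨ ⊃-cong (LatticeProperties.∧-idem latticeₜ x) refl ⟩
    x ⊃ (y ⊃ z)          ∎

  ≼-trans : ∀ {x y z} → x ≼ y → y ≼ z → x ≼ z
  ≼-trans x≼y y≼z =
    Designated-resp (sym (≼-absorb x≼y _)) (Designated-⊃ y≼z)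

  ≋-trans : ∀ {x y z} → x ≋ y → y ≋ z → x ≋ z
  ≋-trans (p , q) (p′ , q′) = ≼-trans p p′ , ≼-trans q′ q

  -- Taking `z` to be `y` and then `x` reduces both directions to reflexivity. Axioms that compare
  -- antecedents thus become equivalences.
  ⊃-≈⇒≋ : ∀ {x y} → (∀ z → x ⊃ z ≈ y ⊃ z) → x ≋ y
  ⊃-≈⇒≋ eq = Designated-resp (sym (eq _)) ≼-refl
           , Designated-resp (eq _) ≼-refl

  -- As x ≤ₜ x ⊗ y and ∼ x ≤ₜ ∼ (x ⊗ y), the elements x and x ⊗ y coincide.
  ≋-separates : ∀ {x y} → x ≋ y → ∼ x ≋ ∼ y → x ≈ y
  ≋-separates {x} {y} (x≼y , y≼x) (∼x≼∼y , ∼y≼∼x) = begin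
    x      ≈⟨ meet x≼y ∼x≼∼y ⟩
    x ⊗ y  ≈⟨ K.∧-comm x y ⟩
    y ⊗ x  ≈⟨ meet y≼x ∼y≼∼x ⟨
    y      ∎
    where
    meet : ∀ {x y} → x ≼ y → ∼ x ≼ ∼ y → x ≈ x ⊗ y
    meet {x} {y} x≼y ∼x≼∼y = OT.antisym (≼⇒≤ₜ⊗ x≼y) (begin
      x ⊗ y                ≈⟨ ∼-involutive _ ⟨
      ∼ ∼ (x ⊗ y)          ≈⟨ ∼-antitoneₜ _ _ ∼x≤∼x⊗y ⟩
      ∼ ∼ (x ⊗ y) ∧ ∼ ∼ x  ≈⟨ ∧-cong (∼-involutive _) (∼-involutive _) ⟩
      (x ⊗ y) ∧ x          ∎)
      where
      ∼x≤∼x⊗y : ∼ x ≤ₜ ∼ (x ⊗ y)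
      ∼x≤∼x⊗y = trans (≼⇒≤ₜ⊗ ∼x≼∼y) (∧-cong refl (sym (∼-⊗ x y)))

  -- Rules of positive classical logic

  curry≼ : ∀ {x y z} → x ∧ y ≼ z → x ≼ y ⊃ z
  curry≼ = Designated-resp (sym (ib2∧ _ _ _))

  uncurry≼ : ∀ {x y z} → x ≼ y ⊃ z → x ∧ y ≼ z
  uncurry≼ = Designated-resp (ib2∧ _ _ _)

  x∧y≼x : ∀ {x y} → x ∧ y ≼ x
  x∧y≼x = ≤ₜ⇒≼ (OT.x∧y≤x _ _)

  x∧y≼y : ∀ {x y} → x ∧ y ≼ y
  x∧y≼y = ≤ₜ⇒≼ (OT.x∧y≤y _ _)

  -- Two uses of `≼-absorb` make `y` and `z` hypotheses beneath `x`, and `y ⊃ (z ⊃ y ∧ z)` is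
  -- designated.
  ∧-greatest : ∀ {x y z} → x ≼ y → x ≼ z → x ≼ y ∧ z
  ∧-greatest x≼y x≼z =
    Designated-resp (sym (trans (≼-absorb x≼z _) (≼-absorb x≼y _)))
      (Designated-⊃ (curry≼ ≼-refl))

  ∧-mono-≼ : ∀ {x x′ y y′} → x ≼ x′ → y ≼ y′ → x ∧ y ≼ x′ ∧ y′
  ∧-mono-≼ p q = ∧-greatest (≼-trans x∧y≼x p) (≼-trans x∧y≼y q)

  x≼x∨y : ∀ {x y} → x ≼ x ∨ y
  x≼x∨y = ≤ₜ⇒≼ (OT.x≤x∨y _ _)

  y≼x∨y : ∀ {x y} → y ≼ x ∨ y
  y≼x∨y = ≤ₜ⇒≼ (OT.y≤x∨y _ _)

  ∨-least : ∀ {x y z} → x ≼ z → y ≼ z → x ∨ y ≼ z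
  ∨-least x≼z y≼z = Designated-resp (sym (ib4∨ _ _ _)) λ w →
    trans (sym (ib2∧ _ _ w)) (trans (x≼z _) (y≼z w))

  ∧≋⊗ : ∀ {x y} → x ∧ y ≋ x ⊗ y
  ∧≋⊗ = ⊃-≈⇒≋ (ib2⊗ _ _)

  ∨≋⊕ : ∀ {x y} → x ∨ y ≋ x ⊕ y
  ∨≋⊕ = ⊃-≈⇒≋ λ z → trans (ib4∨ _ _ z) (ib4⊕ _ _ z)

  ∼-⊃ : ∀ {x y} → x ∧ ∼ y ≋ ∼ (x ⊃ y)
  ∼-⊃ = ⊃-≈⇒≋ λ z → sym (ib6 _ _ z)

  y≼x⊃y : ∀ {x y} → y ≼ x ⊃ y
  y≼x⊃y = curry≼ x∧y≼x

  modusPonens : ∀ {x y z} → z ≼ x → z ≼ x ⊃ y → z ≼ y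
  modusPonens z≼x z≼x⊃y = ≼-trans (∧-greatest z≼x⊃y z≼x) (uncurry≼ ≼-refl)

  peirce : ∀ {x y} → (x ⊃ y) ⊃ x ≼ x
  peirce = Designated-resp (sym (ib3 _ _)) ≼-refl

  -- The goal δ takes the place of falsity, which is not available.
  module Kalmár (δ : Carrier) where

    -- Truth is double negation relative to `δ`: the first clause amounts to `γ ∧ (x ⊃ δ) ≼ δ`, in a
    -- form that discharges the hypothesis `x`. Falsity is refutation relative to `δ`.
    Decides : Carrier → Carrier → Bool → Set (c ⊔ ℓ)
    Decides γ x true  = ∀ {ε} → ε ≼ γ → ε ∧ x ≼ δ → ε ≼ δ
    Decides γ x false = γ ∧ x ≼ δ

    Decides-mono : ∀ {γ γ′ x} p → γ′ ≼ γ → Decides γ x p → Decides γ′ x p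
    Decides-mono true  γ′≼γ d ε≼γ′ = d (≼-trans ε≼γ′ γ′≼γ)
    Decides-mono false γ′≼γ d      = ≼-trans (∧-mono-≼ γ′≼γ ≼-refl) d

    Decides-resp : ∀ {γ x y} p → x ≋ y → Decides γ x p → Decides γ y p
    Decides-resp true  (x≼y , _) d ε≼γ ε∧y≼δ =
      d ε≼γ (≼-trans (∧-mono-≼ ≼-refl x≼y) ε∧y≼δ)
    Decides-resp false (_ , y≼x) d = ≼-trans (∧-mono-≼ ≼-refl y≼x) d

    Decides-∧ : ∀ {γ x y} p q → Decides γ x p → Decides γ y q →
                Decides γ (x ∧ y) (p Bool.∧ q)
    Decides-∧ true true dx dy ε≼γ h =
      dx ε≼γ (dy (≼-trans x∧y≼x ε≼γ) (≼-trans assoc h))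
      where
      assoc : ∀ {x y z} → (x ∧ y) ∧ z ≼ x ∧ (y ∧ z)
      assoc = proj₁ (≈⇒≋ (T.∧-assoc _ _ _))
    Decides-∧ true  false dx dy = ≼-trans (∧-mono-≼ ≼-refl x∧y≼y) dy
    Decides-∧ false _     dx dy = ≼-trans (∧-mono-≼ ≼-refl x∧y≼x) dx

    Decides-∨ : ∀ {γ x y} p q → Decides γ x p → Decides γ y q →
                Decides γ (x ∨ y) (p Bool.∨ q)
    Decides-∨ true _ dx dy ε≼γ h =
      dx ε≼γ (≼-trans (∧-mono-≼ ≼-refl x≼x∨y) h)
    Decides-∨ false true dx dy ε≼γ h =
      dy ε≼γ (≼-trans (∧-mono-≼ ≼-refl y≼x∨y) h)
    Decides-∨ false false dx dy =
      modusPonens x∧y≼x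
        (≼-trans x∧y≼y (∨-least (exchange dx) (exchange dy)))
      where
      exchange : ∀ {x y z} → x ∧ y ≼ z → y ≼ x ⊃ z
      exchange h = curry≼ (≼-trans (∧-greatest x∧y≼y x∧y≼x) h)

    Decides-⊃ : ∀ {γ x y} p q → Decides γ x p → Decides γ y q →
                Decides γ (x ⊃ y) (not p Bool.∨ q)
    Decides-⊃ true true dx dy ε≼γ h =
      dy ε≼γ (≼-trans (∧-mono-≼ ≼-refl y≼x⊃y) h)
    Decides-⊃ true false dx dy =
      dx x∧y≼x (≼-trans
        (∧-greatest (≼-trans x∧y≼x x∧y≼x)
                    (modusPonens x∧y≼y (≼-trans x∧y≼x x∧y≼y)))
        dy)
    Decides-⊃ {γ} {x} {y} false _ dx dy {ε} ε≼γ h =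
      -- A refuted `x` yields only `δ`, which need not entail `y`. Under the extra hypothesis
      -- `δ ⊃ y` it does, so `x ⊃ y` holds there and `h` gives `δ`; Peirce's law then removes the
      -- hypothesis.
      ≼-trans (curry≼ (≼-trans (∧-greatest x∧y≼x (curry≼ δ⇒y)) h)) peirce
      where
      δ⇒y : (ε ∧ (δ ⊃ y)) ∧ x ≼ y
      δ⇒y = modusPonens
        (≼-trans (∧-mono-≼ (≼-trans x∧y≼x ε≼γ) ≼-refl) dx)
        (≼-trans x∧y≼x x∧y≼y)

    -- The true branch, run in the context `γ ∧ x`, proves `γ ≼ x ⊃ δ`. So `γ` lies below
    -- `γ ∧ (x ⊃ δ)`, where `x` is false and the other branch applies.
    cases : ∀ x {γ} →
            (∀ {γ′} → γ′ ≼ γ → ∀ p → Decides γ′ x p → γ′ ≼ δ) → γ ≼ δ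
    cases x {γ} k = ≼-trans (∧-greatest ≼-refl (curry≼ γ∧x≼δ)) γ∧x⊃δ≼δ
      where
      γ∧x≼δ : γ ∧ x ≼ δ
      γ∧x≼δ = k x∧y≼x true λ ε≼γ∧x h →
        ≼-trans (∧-greatest ≼-refl (≼-trans ε≼γ∧x x∧y≼y)) h
      γ∧x⊃δ≼δ : γ ∧ (x ⊃ δ) ≼ δ
      γ∧x⊃δ≼δ = k x∧y≼x false (uncurry≼ x∧y≼y)

    -- The literals `x` and `∼ x` are decided independently of each other.
    Decides₄ : Carrier → Carrier → Four → Set (c ⊔ ℓ)
    Decides₄ γ x (p , q) = Decides γ x p × Decides γ (∼ x) q

    Decides₄-mono : ∀ {γ γ′ x} v → γ′ ≼ γ → Decides₄ γ x v → Decides₄ γ′ x v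
    Decides₄-mono (p , q) γ′≼γ (d , d′) =
      Decides-mono p γ′≼γ d , Decides-mono q γ′≼γ d′

    -- Only listed variables are constrained, since `cases` can be applied only finitely often.
    Agrees : (ℕ → Carrier) → List ℕ → Carrier → (ℕ → Four) → Set (c ⊔ ℓ)
    Agrees ρ is γ v = ∀ {i} → i ∈ is → Decides₄ γ (ρ i) (v i)

    Agrees-∷ : ∀ {ρ is γ γ′ v i w} → γ′ ≼ γ → Decides₄ γ′ (ρ i) w →
               Agrees ρ is γ v →
               Agrees ρ (i List.∷ is) γ′ (λ j → case i ℕ.≟ j of λ
                 { (yes _) → w ; (no _) → v j })
    Agrees-∷ {i = i} γ′≼γ d ds {j} j∈ with i ℕ.≟ j
    ... | yes ≡.refl = d
    Agrees-∷ γ′≼γ d ds (here j≡i) | no i≢j = contradiction (≡.sym j≡i) i≢j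
    Agrees-∷ {v = v} γ′≼γ d ds {j} (there j∈) | no _ =
      Decides₄-mono (v j) γ′≼γ (ds j∈)

    split : ∀ ρ is {γ} →
            (∀ {γ′} → γ′ ≼ γ → ∀ v → Agrees ρ is γ′ v → γ′ ≼ δ) → γ ≼ δ
    -- With no variable listed every valuation agrees; the constant one is an arbitrary choice.
    split ρ List.[]       k = k ≼-refl (λ _ → false , false) λ ()
    split ρ (i List.∷ is) k = split ρ is λ γ₁≼γ v ds →
      cases (ρ i) λ γ₂≼γ₁ p dp →
      cases (∼ ρ i) λ γ₃≼γ₂ q dq →
      k (≼-trans γ₃≼γ₂ (≼-trans γ₂≼γ₁ γ₁≼γ)) _
        (Agrees-∷ {w = p , q} (≼-trans γ₃≼γ₂ γ₂≼γ₁)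
          (Decides-mono p γ₃≼γ₂ dp , dq) ds)

    -- Each component of a table of `four` is a classical connective in the literals of the
    -- arguments: De Morgan laws push `∼` inwards, `⊗` and `⊕` act as `∧` and `∨` up to `≋`, and
    -- `∼-⊃` treats a negated implication.
    Decides₄-apply : ∀ f {γ xs} vs → (∀ i → Decides₄ γ (xs i) (vs i)) →
                     Decides₄ γ (apply f xs) (Algebra.interp four f vs)
    Decides₄-apply ∧′ vs d with vs 0F | vs 1F | d 0F | d 1F
    ... | p , q | p′ , q′ | dp , dq | dp′ , dq′ =
      Decides-∧ p p′ dp dp′ ,
      Decides-resp (q Bool.∨ q′) (≈⇒≋ (sym (∼-∧ _ _)))
        (Decides-∨ q q′ dq dq′)
    Decides₄-apply ∨′ vs d with vs 0F | vs 1F | d 0F | d 1F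
    ... | p , q | p′ , q′ | dp , dq | dp′ , dq′ =
      Decides-∨ p p′ dp dp′ ,
      Decides-resp (q Bool.∧ q′) (≈⇒≋ (sym (∼-∨ _ _)))
        (Decides-∧ q q′ dq dq′)
    Decides₄-apply ⊗′ vs d with vs 0F | vs 1F | d 0F | d 1F
    ... | p , q | p′ , q′ | dp , dq | dp′ , dq′ =
      Decides-resp (p Bool.∧ p′) ∧≋⊗ (Decides-∧ p p′ dp dp′) ,
      Decides-resp (q Bool.∧ q′) (≋-trans ∧≋⊗ (≈⇒≋ (sym (∼-⊗ _ _))))
        (Decides-∧ q q′ dq dq′)
    Decides₄-apply ⊕′ vs d with vs 0F | vs 1F | d 0F | d 1F
    ... | p , q | p′ , q′ | dp , dq | dp′ , dq′ =
      Decides-resp (p Bool.∨ p′) ∨≋⊕ (Decides-∨ p p′ dp dp′) ,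
      Decides-resp (q Bool.∨ q′) (≋-trans ∨≋⊕ (≈⇒≋ (sym (∼-⊕ _ _))))
        (Decides-∨ q q′ dq dq′)
    Decides₄-apply ⊃′ vs d with vs 0F | vs 1F | d 0F | d 1F
    ... | p , q | p′ , q′ | dp , dq | dp′ , dq′ =
      Decides-⊃ p p′ dp dp′ ,
      Decides-resp (p Bool.∧ q′) ∼-⊃ (Decides-∧ p q′ dp dq′)
    Decides₄-apply ¬′ vs d with vs 0F | d 0F
    ... | p , q | dp , dq =
      dq , Decides-resp p (≈⇒≋ (sym (∼-involutive _))) dp

    Decides₄-⟦⟧ : ∀ {ρ γ v} t → Agrees ρ (variables t) γ v →
                  Decides₄ γ (⟦ t ⟧ ρ) (eval four v t)
    Decides₄-⟦⟧ (var i)   ds = ds (here ≡.refl)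
    Decides₄-⟦⟧ (op f ts) ds = Decides₄-apply f _ λ i →
      Decides₄-⟦⟧ (ts i) (ds ∘ variables-op f ts i)

  -- Completeness with respect to the four-element algebra

  open Kalmár using (Decides; Decides₄-⟦⟧; Agrees; split)

  -- Kalmár's method runs with `y` as the goal and `x` as the initial context. If `α v` is true, `y`
  -- is discharged from `γ ∧ y ≼ y`; if it is false, `x` is refuted relative to `y` while `γ ≼ x`.
  entails : ∀ ρ is {x y} (α : (ℕ → Four) → Bool) →
            (∀ {δ γ v} → Agrees δ ρ is γ v → Decides δ γ x (α v)) →
            (∀ {δ γ v} → Agrees δ ρ is γ v → Decides δ γ y (α v)) →
            x ≼ y
  entails ρ is {x} {y} α dx dy =
    split y ρ is λ γ≼x v ds → conclude (α v) γ≼x (dx ds) (dy ds)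
    where
    conclude : ∀ {γ} p → γ ≼ x → Decides y γ x p → Decides y γ y p → γ ≼ y
    conclude true  γ≼x _ d = d ≼-refl x∧y≼y
    conclude false γ≼x d _ = ≼-trans (∧-greatest ≼-refl γ≼x) d

  complete : ∀ e → four ⊨ e → B ⊨ e
  complete (s , t) four⊨e ρ =
    trans (sym (⟦⟧≈eval ρ s)) (trans s≈t (⟦⟧≈eval ρ t))
    where
    is = variables s ++ variables t

    ds : ∀ {δ γ v} → Agrees δ ρ is γ v →
         Kalmár.Decides₄ δ γ (⟦ s ⟧ ρ) (eval four v s)
    ds {δ} h = Decides₄-⟦⟧ δ s (h ∘ ∈-++⁺ˡ)

    -- Validity in `four` gives `t` the value computed from `s`, so that both terms share one `α` in
    -- `entails`.
    dt : ∀ {δ γ v} → Agrees δ ρ is γ v →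
         Kalmár.Decides₄ δ γ (⟦ t ⟧ ρ) (eval four v s)
    dt {δ} {γ} {v} h = ≡.subst (Kalmár.Decides₄ δ γ (⟦ t ⟧ ρ))
      (≡.sym (four⊨e v)) (Decides₄-⟦⟧ δ t (h ∘ ∈-++⁺ʳ (variables s)))

    true? false? : (ℕ → Four) → Bool
    true?  v = proj₁ (eval four v s)
    false? v = proj₂ (eval four v s)

    s≈t : ⟦ s ⟧ ρ ≈ ⟦ t ⟧ ρ
    s≈t = ≋-separates
      ( entails ρ is true? (λ h → proj₁ (ds h)) (λ h → proj₁ (dt h))
      , entails ρ is true? (λ h → proj₁ (dt h)) (λ h → proj₁ (ds h)) )
      ( entails ρ is false? (λ h → proj₂ (ds h)) (λ h → proj₂ (dt h))
      , entails ρ is false? (λ h → proj₂ (dt h)) (λ h → proj₂ (ds h)) )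

-- The variety generated by the four-element algebra

TheoryOfFour : Equation implicativeBilatticeSignature → Set
TheoryOfFour e = four ⊨ e

Valid : (s t : ImpTerm (Fin 3)) → Set
Valid s t = ∀ x y z → eval four (x ∷ y ∷ z ∷ []) s ≡ eval four (x ∷ y ∷ z ∷ []) t

valid? : ∀ s t → Dec (Valid s t)
valid? s t = ∀-four? λ x → ∀-four? λ y → ∀-four? λ z →
  eval four (x ∷ y ∷ z ∷ []) s ≟ eval four (x ∷ y ∷ z ∷ []) t

Valid⇒four⊨ : ∀ s t → Valid s t → four ⊨ (rename toℕ s , rename toℕ t)
Valid⇒four⊨ s t valid ρ =
  ≡.trans (eval-rename four restrict s)
    (≡.trans (valid _ _ _) (≡.sym (eval-rename four restrict t)))
  where
  restrict : ∀ i → ρ (toℕ i) ≡ (ρ 0 ∷ ρ 1 ∷ ρ 2 ∷ []) i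
  restrict 0F = ≡.refl
  restrict 1F = ≡.refl
  restrict 2F = ≡.refl

module _ {B : Algebra implicativeBilatticeSignature c ℓ}
         (B⊨ : Mod TheoryOfFour B) where
  open Algebra B
  open Operations B
  open OperationProperties B

  private
    infix 4 _≈̂_
    -- The implicit argument is solved by evaluating the truth tables, so each identity written with
    -- this operator is checked in `four` and transferred to `B`.
    _≈̂_ : ∀ s t → {True (valid? s t)} → ∀ x y z →
           let ρ = x ∷ y ∷ z ∷ [] in ⟦ s ⟧ ρ ≈ ⟦ t ⟧ ρ
    (s ≈̂ t) {valid} x y z =
      trans (trans (⟦⟧≈eval _ s) (sym (eval-rename B restrict s)))
        (trans (B⊨ (rename toℕ s , rename toℕ t)
                  (Valid⇒four⊨ s t (toWitness valid)) σ)
          (trans (eval-rename B restrict t) (sym (⟦⟧≈eval _ t))))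
      where
      σ : ℕ → Carrier
      σ 0 = x
      σ 1 = y
      σ _ = z
      restrict : ∀ i → σ (toℕ i) ≈ (x ∷ y ∷ z ∷ []) i
      restrict 0F = refl
      restrict 1F = refl
      restrict 2F = refl

    x̂ ŷ ẑ : ImpTerm (Fin 3)
    x̂ = var 0F
    ŷ = var 1F
    ẑ = var 2F

  Mod⇒bilattice : IsBilattice B
  Mod⇒bilattice = record
    { isLatticeₜ = record
      { isEquivalence = isEquivalence
      ; ∨-comm        = λ x y → (x̂ ∨̂ ŷ ≈̂ ŷ ∨̂ x̂) x y y
      ; ∨-assoc       = (x̂ ∨̂ ŷ) ∨̂ ẑ ≈̂ x̂ ∨̂ (ŷ ∨̂ ẑ)
      ; ∨-cong        = ∨-cong
      ; ∧-comm        = λ x y → (x̂ ∧̂ ŷ ≈̂ ŷ ∧̂ x̂) x y y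
      ; ∧-assoc       = (x̂ ∧̂ ŷ) ∧̂ ẑ ≈̂ x̂ ∧̂ (ŷ ∧̂ ẑ)
      ; ∧-cong        = ∧-cong
      ; absorptive    = (λ x y → (x̂ ∨̂ (x̂ ∧̂ ŷ) ≈̂ x̂) x y y)
                      , (λ x y → (x̂ ∧̂ (x̂ ∨̂ ŷ) ≈̂ x̂) x y y)
      }
    ; isLatticeₖ = record
      { isEquivalence = isEquivalence
      ; ∨-comm        = λ x y → (x̂ ⊕̂ ŷ ≈̂ ŷ ⊕̂ x̂) x y y
      ; ∨-assoc       = (x̂ ⊕̂ ŷ) ⊕̂ ẑ ≈̂ x̂ ⊕̂ (ŷ ⊕̂ ẑ)
      ; ∨-cong        = ⊕-cong
      ; ∧-comm        = λ x y → (x̂ ⊗̂ ŷ ≈̂ ŷ ⊗̂ x̂) x y y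
      ; ∧-assoc       = (x̂ ⊗̂ ŷ) ⊗̂ ẑ ≈̂ x̂ ⊗̂ (ŷ ⊗̂ ẑ)
      ; ∧-cong        = ⊗-cong
      ; absorptive    = (λ x y → (x̂ ⊕̂ (x̂ ⊗̂ ŷ) ≈̂ x̂) x y y)
                      , (λ x y → (x̂ ⊗̂ (x̂ ⊕̂ ŷ) ≈̂ x̂) x y y)
      }
    -- The two monotonicity conditions are implications; each follows from an identity of `four` by
    -- substituting `x ∧ y` or `x ⊗ y` for `x`.
    ; ∼-antitoneₜ  = λ x y x≤y →
        trans ((∼̂ ŷ ≈̂ ∼̂ ŷ ∧̂ ∼̂ (x̂ ∧̂ ŷ)) x y y)
          (∧-cong refl (∼-cong (sym x≤y)))
    ; ∼-monotoneₖ  = λ x y x≤y →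
        trans (∼-cong x≤y)
          (trans ((∼̂ (x̂ ⊗̂ ŷ) ≈̂ ∼̂ (x̂ ⊗̂ ŷ) ⊗̂ ∼̂ ŷ) x y y)
            (⊗-cong (∼-cong (sym x≤y)) refl))
    ; ∼-involutive = λ x → (∼̂ ∼̂ x̂ ≈̂ x̂) x x x
    }

  Mod⇒ImpBiLat : IsImplicativeBilattice B
  Mod⇒ImpBiLat = record
    { isBilattice = Mod⇒bilattice
    ; ib1  = λ x y → ((x̂ ⊃̂ x̂) ⊃̂ ŷ ≈̂ ŷ) x y y
    ; ib2∧ = x̂ ⊃̂ (ŷ ⊃̂ ẑ) ≈̂ (x̂ ∧̂ ŷ) ⊃̂ ẑ
    ; ib2⊗ = (x̂ ∧̂ ŷ) ⊃̂ ẑ ≈̂ (x̂ ⊗̂ ŷ) ⊃̂ ẑ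
    ; ib3  = λ x y → (((x̂ ⊃̂ ŷ) ⊃̂ x̂) ⊃̂ x̂ ≈̂ x̂ ⊃̂ x̂) x y y
    ; ib4∨ = (x̂ ∨̂ ŷ) ⊃̂ ẑ ≈̂ (x̂ ⊃̂ ẑ) ∧̂ (ŷ ⊃̂ ẑ)
    ; ib4⊕ = (x̂ ⊃̂ ẑ) ∧̂ (ŷ ⊃̂ ẑ) ≈̂ (x̂ ⊕̂ ŷ) ⊃̂ ẑ
    ; ib5  = λ x y → (x̂ ∧̂ ((x̂ ⊃̂ ŷ) ⊃̂ (x̂ ⊗̂ ŷ)) ≈̂ x̂) x y y
    ; ib6  = ∼̂ (x̂ ⊃̂ ŷ) ⊃̂ ẑ ≈̂ (x̂ ∧̂ ∼̂ ŷ) ⊃̂ ẑ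
    }

module _ (c ℓ : Level) where

  Generators : Algebra implicativeBilatticeSignature c ℓ → Set _
  Generators A = A ≡ liftAlgebra c ℓ four

  generates : ImpBiLat c ℓ IsGeneratedBy Generators
  generates = record
    { isVariety = TheoryOfFour
                , (λ B∈ e → Logic.complete B∈ e)
                , Mod⇒ImpBiLat
    ; contains  = λ { ≡.refl → Mod⇒ImpBiLat (⊨-lift c ℓ four) }
    -- Equations of the lifted algebra hold in `four`, and completeness carries them to every
    -- implicative bilattice.
    ; least     = λ E K⊆ B∈ e e∈E →
        Logic.complete B∈ e (⊨-lower c ℓ four e (K⊆ ≡.refl e e∈E))
    }

-- The discriminator term

discriminator : ImpTerm (Fin 3)
-- Negation swaps components, so the second summand supplies the required second component. As `⊕`
-- is a componentwise disjunction, the unwanted components, lying below the required ones, are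
-- absorbed.
discriminator = select x z ⊕̂ ∼̂ select (∼̂ x) (∼̂ z)
  where
  x = var 0F
  y = var 1F
  z = var 2F
  x≡y : ImpTerm (Fin 3)
  x≡y = (x ⊃̂ y) ∧̂ (y ⊃̂ x) ∧̂ (∼̂ x ⊃̂ ∼̂ y) ∧̂ (∼̂ y ⊃̂ ∼̂ x)
  -- The first component of the value is that of z if x and y agree and that
  -- of x otherwise; the second is below the one required.
  select : ImpTerm (Fin 3) → ImpTerm (Fin 3) → ImpTerm (Fin 3)
  select s t = ((x≡y ⊃̂ s) ⊃̂ s) ⊗̂ (x≡y ⊃̂ t)

discriminates : (A : Algebra implicativeBilatticeSignature c ℓ) →
                Generators c ℓ A → InducesDiscriminator discriminator A
discriminates {c} {ℓ} _ ≡.refl = record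
  { equal   = λ { x y z (lift ≡.refl) → lift (onEqual (lower x) (lower z)) }
  ; unequal = λ x y z x≢y → lift
      ([ (λ x≡y → contradiction (lift x≡y) x≢y) , (λ eq → eq) ]′
        (onUnequal (lower x) (lower y) (lower z)))
  }
  where
  induced : Four → Four → Four → Four
  induced x y z = eval four (x ∷ y ∷ z ∷ []) discriminator

  onEqual : ∀ x z → induced x x z ≡ z
  onEqual = from-yes (∀-four? λ x → ∀-four? λ z → induced x x z ≟ z)

  -- The disjunction replaces an implication from inequality, so that a finite search decides it
  -- directly.
  onUnequal : ∀ x y z → x ≡ y ⊎ induced x y z ≡ x
  onUnequal = from-yes (∀-four? λ x → ∀-four? λ y → ∀-four? λ z →
    x ≟ y ⊎-dec induced x y z ≟ x)

proposition5p2p2 : ∀ (c ℓ : Level) → IsDiscriminatorVariety (ImpBiLat c ℓ)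
proposition5p2p2 c ℓ =
  Generators c ℓ , discriminator , generates c ℓ , discriminates
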